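{- For every $n\geq 1$ and every $w\in\{0,1\}^n$, there is a prenex first-order sentence over $\tau_{\mathsf{string}}$ with $3\lceil \log_3 n\rceil$ quantifiers, whose quantifier prefix consists of $\lceil\log_3 n\rceil$ consecutive blocks $\exists\exists\forall$, that is true in $\mathbf{B}_w$ and false in $\mathbf{B}_{w'}$ for every $w'\in\{0,1\}^n\setminus\{w\}$.
   Context: Vocabulary $\tau_{\mathsf{string}}=\langle <, S;\ \mathsf{min},\mathsf{max}\rangle$ with $<$ binary, $S$ unary, $\mathsf{min},\mathsf{max}$ constants. A string $w=w_1\cdots w_n\in\{0,1\}^n$ ($n\geq 1$) is encoded by the structure $\mathbf{B}_w$ with universe $\{1,\dots,n\}$, $<$ the usual order, $S=\{i: w_i=1\}$, $\mathsf{min}=1$, $\mathsf{max}=n$. The number of quantifiers is the number of quantifier occurrences. -}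

module Defs where

open import Data.Bool using (Bool; true)
open import Data.Fin as Fin using (Fin; zero; fromℕ)
open import Data.List using (List; []; _∷_; concat; replicate)
open import Data.Nat using (ℕ; zero; suc; _+_; _^_; _≤_; _≤?_; NonZero; z≤n; s≤s)
open import Data.Nat.Properties
  using (≤-refl; ≤-trans; ≤-reflexive; <⇒≤; +-suc; +-identityʳ; ≤∧≢⇒<; +-mono-≤; m≤m+n)
open import Data.Product using (Σ; _×_)
open import Data.Sum using (_⊎_)
open import Data.Vec using (Vec; []; _∷_; lookup)
open import Relation.Binary.PropositionalEquality using (_≡_; refl; sym; subst)
open import Relation.Nullary using (¬_; yes; no)

-- Syntax.  First-order logic with equality over ⟨<, S; min, max⟩, with
-- de Bruijn variables: a Term k or Formula k has its free variables in
-- Fin k, and a sentence is a Formula 0.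

data Term (k : ℕ) : Set where
  var     : Fin k → Term k
  min max : Term k

infix  8 _≐_ _≺_
infix  7 ¬′_
infixr 6 _∧′_
infixr 5 _∨′_
infixr 4 _⇒′_
infix  3 ∃′_ ∀′_

data Formula (k : ℕ) : Set where
  _≐_ _≺_          : Term k → Term k → Formula k
  S                : Term k → Formula k
  ¬′_              : Formula k → Formula k
  _∧′_ _∨′_ _⇒′_   : Formula k → Formula k → Formula k
  ∃′_ ∀′_          : Formula (suc k) → Formula k

Sentence : Set
Sentence = Formula 0

#quantifiers : ∀ {k} → Formula k → ℕ
#quantifiers (s ≐ t)  = 0
#quantifiers (s ≺ t)  = 0
#quantifiers (S t)    = 0
#quantifiers (¬′ φ)   = #quantifiers φ
#quantifiers (φ ∧′ ψ) = #quantifiers φ + #quantifiers ψ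
#quantifiers (φ ∨′ ψ) = #quantifiers φ + #quantifiers ψ
#quantifiers (φ ⇒′ ψ) = #quantifiers φ + #quantifiers ψ
#quantifiers (∃′ φ)   = suc (#quantifiers φ)
#quantifiers (∀′ φ)   = suc (#quantifiers φ)

data Quantifier : Set where
  ∃q ∀q : Quantifier

-- PrenexWithPrefix qs φ: φ consists of the quantifiers qs, outermost first,
-- followed by a quantifier-free matrix.
data PrenexWithPrefix {k : ℕ} : List Quantifier → Formula k → Set where
  matrix : ∀ {φ} → #quantifiers φ ≡ 0 → PrenexWithPrefix [] φ
  ∃-step : ∀ {qs φ} → PrenexWithPrefix qs φ → PrenexWithPrefix (∃q ∷ qs) (∃′ φ)
  ∀-step : ∀ {qs φ} → PrenexWithPrefix qs φ → PrenexWithPrefix (∀q ∷ qs) (∀′ φ)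

∃∃∀-blocks : ℕ → List Quantifier
∃∃∀-blocks b = concat (replicate b (∃q ∷ ∃q ∷ ∀q ∷ []))

record Structure : Set₁ where
  field
    Universe : Set
    _<ᴬ_     : Universe → Universe → Set
    Sᴬ       : Universe → Set
    minᴬ     : Universe
    maxᴬ     : Universe

module Semantics (𝔸 : Structure) where
  open Structure 𝔸

  ⟦_⟧ : ∀ {k} → Term k → Vec Universe k → Universe
  ⟦ var i ⟧ ρ = lookup ρ i
  ⟦ min   ⟧ ρ = minᴬ
  ⟦ max   ⟧ ρ = maxᴬ

  -- Over the structures 𝐁 w below (finite universe, decidable relations)
  -- this constructive reading agrees with classical truth.
  Sat : ∀ {k} → Vec Universe k → Formula k → Set
  Sat ρ (s ≐ t)  = ⟦ s ⟧ ρ ≡ ⟦ t ⟧ ρ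
  Sat ρ (s ≺ t)  = ⟦ s ⟧ ρ <ᴬ ⟦ t ⟧ ρ
  Sat ρ (S t)    = Sᴬ (⟦ t ⟧ ρ)
  Sat ρ (¬′ φ)   = ¬ Sat ρ φ
  Sat ρ (φ ∧′ ψ) = Sat ρ φ × Sat ρ ψ
  Sat ρ (φ ∨′ ψ) = Sat ρ φ ⊎ Sat ρ ψ
  Sat ρ (φ ⇒′ ψ) = Sat ρ φ → Sat ρ ψ
  Sat ρ (∃′ φ)   = Σ Universe λ a → Sat (a ∷ ρ) φ
  Sat ρ (∀′ φ)   = (a : Universe) → Sat (a ∷ ρ) φ

infix 2 _⊨_
_⊨_ : Structure → Sentence → Set
𝔸 ⊨ φ = Semantics.Sat 𝔸 [] φ

first last : ∀ n → .{{NonZero n}} → Fin n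
first (suc m) = zero
last  (suc m) = fromℕ m

-- The universe {1, …, n} is represented by Fin n, position i being the
-- element with toℕ equal to i - 1; the bit 1 is true.
𝐁 : ∀ {n} → .{{NonZero n}} → Vec Bool n → Structure
𝐁 {n} w = record
  { Universe = Fin n
  ; _<ᴬ_     = Fin._<_
  ; Sᴬ       = λ i → lookup w i ≡ true
  ; minᴬ     = first n
  ; maxᴬ     = last n
  }

-- For n ≥ 1, ⌈log₃ n⌉ is the least k with n ≤ 3 ^ k (see ≤3^⌈log₃⌉ and
-- ⌈log₃⌉-least).  The search is bounded by n, which suffices as n ≤ 3 ^ n.
-- At n = 0 the value is 0 by convention.
searchLog₃ : (fuel n k : ℕ) → ℕ
searchLog₃ zero       n k = k
searchLog₃ (suc fuel) n k with n ≤? 3 ^ k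
... | yes _ = k
... | no  _ = searchLog₃ fuel n (suc k)

⌈log₃_⌉ : ℕ → ℕ
⌈log₃ n ⌉ = searchLog₃ n n 0

n≤3^n : ∀ n → n ≤ 3 ^ n
n≤3^n n = <⇒≤ (n<3^n n)
  where
  n<3^n : ∀ n → suc n ≤ 3 ^ n
  n<3^n zero    = ≤-refl
  n<3^n (suc n) =
    ≤-trans (s≤s (n<3^n n))
      (≤-trans (+-mono-≤ (≤-trans (s≤s z≤n) (n<3^n n)) ≤-refl)
        (+-mono-≤ (≤-refl {3 ^ n}) (m≤m+n (3 ^ n) _)))

≤3^⌈log₃⌉ : ∀ n → n ≤ 3 ^ ⌈log₃ n ⌉
≤3^⌈log₃⌉ n = go n 0 (≤-trans (n≤3^n n) (≤-reflexive (lem n)))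
  where
  lem : ∀ m → 3 ^ m ≡ 3 ^ (m + 0)
  lem m rewrite +-identityʳ m = refl
  go : ∀ fuel k → n ≤ 3 ^ (fuel + k) → n ≤ 3 ^ searchLog₃ fuel n k
  go zero       k p = p
  go (suc fuel) k p with n ≤? 3 ^ k
  ... | yes q = q
  ... | no  _ = go fuel (suc k) (subst (λ e → n ≤ 3 ^ e) (sym (+-suc fuel k)) p)

⌈log₃⌉-least : ∀ n j → n ≤ 3 ^ j → ⌈log₃ n ⌉ ≤ j
⌈log₃⌉-least n j p = go n 0 z≤n
  where
  go : ∀ fuel k → k ≤ j → searchLog₃ fuel n k ≤ j
  go zero       k k≤j = k≤j
  go (suc fuel) k k≤j with n ≤? 3 ^ k
  ... | yes _ = k≤j
  ... | no ¬q = go fuel (suc k) (≤∧≢⇒< k≤j λ { refl → ¬q p })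

-- Call a segment [a, b] of w′ an overlong or exact copy of the segment [p, q]
-- of w if q - p ≤ b - a and, in case of equality, the letters agree.  This
-- relation composes along a common endpoint, because lengths add up: if the
-- total is exact, then so is every piece.  Hence a segment of length at most
-- 3 ^ (k + 1) is described by guessing two cut points (∃∃) and letting the
-- universal player pick one of the three pieces (∀), each of which has length
-- at most 3 ^ k.  The pick is encoded as z = min, z = max or neither, so that
-- for every z exactly one piece is under examination and the three
-- descriptions can share their remaining quantifiers.  Since all strings have
-- the same length n, an overlong or exact copy of w is w itself.
module Submission where

open import Defs
open import Data.Bool using (Bool; true; false)
open import Data.Bool.Properties using (¬-not)
open import Data.Fin using (Fin; zero; suc; toℕ; fromℕ; fromℕ<; _≟_) renaming (_≤_ to _≤ᶠ_)
open import Data.Fin.Properties using (toℕ-injective; toℕ-fromℕ<; toℕ<n; ≤fromℕ)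
open import Data.List using (length)
open import Data.Nat using (ℕ; zero; suc; _+_; _*_; _^_; _≤_; _≤?_; NonZero; z≤n; s≤s⁻¹)
open import Data.Nat.Properties
  using (≤-refl; ≤-trans; ≤-reflexive; ≤-antisym; <⇒≤; ≰⇒>; m≤n⇒m<n∨m≡n; m≤n+m; *-suc;
         +-comm; +-assoc; +-identityʳ; +-monoˡ-≤; +-monoʳ-≤; +-mono-≤;
         +-cancelʳ-≤; +-cancelʳ-≡; +-cancelˡ-≡)
open import Data.Nat.Solver using (module +-*-Solver)
open import Data.Product using (Σ; _×_; _,_; ∃-syntax)
open import Data.Sum using (inj₁; inj₂)
open import Data.Vec using (Vec; []; _∷_; lookup)
open import Data.Vec.Properties using (tabulate∘lookup; tabulate-cong)
open import Function using (_∘_; id)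
open import Function.Bundles using (_⇔_; mk⇔; Equivalence)
open import Relation.Binary.PropositionalEquality
  using (_≡_; _≢_; refl; sym; trans; cong; cong₂; subst)
open import Relation.Nullary using (¬_; yes; no; contradiction)

open Equivalence using (to; from)
open Semantics using (Sat; ⟦_⟧)
open Structure using (Universe)
open +-*-Solver using (solve; _:+_; _:=_)

-- Case distinctions under a shared quantifier prefix.

weaken : ∀ {k} → Term k → Term (suc k)
weaken (var i) = var (suc i)
weaken min     = min
weaken max     = max

⟦weaken⟧ : ∀ 𝔸 {k} a (ρ : Vec (Universe 𝔸) k) t → ⟦_⟧ 𝔸 (weaken t) (a ∷ ρ) ≡ ⟦_⟧ 𝔸 t ρ
⟦weaken⟧ 𝔸 a ρ (var i) = refl
⟦weaken⟧ 𝔸 a ρ min     = refl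
⟦weaken⟧ 𝔸 a ρ max     = refl

#quantifiers-prefix : ∀ {k qs} {φ : Formula k} → PrenexWithPrefix qs φ → #quantifiers φ ≡ length qs
#quantifiers-prefix (matrix eq) = eq
#quantifiers-prefix (∃-step p)  = cong suc (#quantifiers-prefix p)
#quantifiers-prefix (∀-step p)  = cong suc (#quantifiers-prefix p)

length-∃∃∀-blocks : ∀ b → length (∃∃∀-blocks b) ≡ 3 * b
length-∃∃∀-blocks zero    = refl
length-∃∃∀-blocks (suc b) = trans (cong (3 +_) (length-∃∃∀-blocks b)) (sym (*-suc 3 b))

-- Equality in an arbitrary structure cannot be decided constructively, so each case is conditional
-- on the outcome of the test.
record IfEqual {k} (s t : Term k) (φ ψ χ : Formula k) : Set₁ where
  field
    if-≡ : ∀ 𝔸 ρ → ⟦_⟧ 𝔸 s ρ ≡ ⟦_⟧ 𝔸 t ρ → Sat 𝔸 ρ φ ⇔ Sat 𝔸 ρ χ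
    if-≢ : ∀ 𝔸 ρ → ⟦_⟧ 𝔸 s ρ ≢ ⟦_⟧ 𝔸 t ρ → Sat 𝔸 ρ ψ ⇔ Sat 𝔸 ρ χ

open IfEqual

⟦weaken⟧-≡ : ∀ {k} (s t : Term k) 𝔸 a ρ →
  (⟦_⟧ 𝔸 (weaken s) (a ∷ ρ) ≡ ⟦_⟧ 𝔸 (weaken t) (a ∷ ρ)) ≡ (⟦_⟧ 𝔸 s ρ ≡ ⟦_⟧ 𝔸 t ρ)
⟦weaken⟧-≡ s t 𝔸 a ρ = cong₂ _≡_ (⟦weaken⟧ 𝔸 a ρ s) (⟦weaken⟧ 𝔸 a ρ t)

Σ-cong-⇔ : {A : Set} {P Q : A → Set} → (∀ a → P a ⇔ Q a) → Σ A P ⇔ Σ A Q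
Σ-cong-⇔ e = mk⇔ (λ (a , x) → a , to (e a) x) (λ (a , x) → a , from (e a) x)

Π-cong-⇔ : {A : Set} {P Q : A → Set} → (∀ a → P a ⇔ Q a) → (∀ a → P a) ⇔ (∀ a → Q a)
Π-cong-⇔ e = mk⇔ (λ f a → to (e a) (f a)) (λ f a → from (e a) (f a))

-- The case distinction is made in the matrix, so that φ and ψ share their
-- quantifiers.
ifEqual : ∀ {k qs} (s t : Term k) {φ ψ} → PrenexWithPrefix qs φ → PrenexWithPrefix qs ψ →
          ∃[ χ ] PrenexWithPrefix qs χ × IfEqual s t φ ψ χ
ifEqual s t {φ} {ψ} (matrix p) (matrix q) =
  ((s ≐ t ⇒′ φ) ∧′ (¬′ (s ≐ t) ⇒′ ψ)) , matrix (cong₂ _+_ p q) ,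
  record
  { if-≡ = λ 𝔸 ρ eq → mk⇔ (λ x → (λ _ → x) , λ neq → contradiction eq neq) (λ (f , _) → f eq)
  ; if-≢ = λ 𝔸 ρ neq → mk⇔ (λ x → (λ eq → contradiction eq neq) , λ _ → x) (λ (_ , g) → g neq)
  }
-- The weakened test terms ignore the bound variable: the outcome is fixed before the prefix is
-- played, and a witness for the selected formula is one for `χ`.
ifEqual s t (∃-step p) (∃-step q) with ifEqual (weaken s) (weaken t) p q
... | χ , prenex , spec = (∃′ χ) , ∃-step prenex , record
  { if-≡ = λ 𝔸 ρ eq → Σ-cong-⇔ λ a → if-≡ spec 𝔸 (a ∷ ρ) (subst id (sym (⟦weaken⟧-≡ s t 𝔸 a ρ)) eq)
  ; if-≢ = λ 𝔸 ρ neq → Σ-cong-⇔ λ a → if-≢ spec 𝔸 (a ∷ ρ) (neq ∘ subst id (⟦weaken⟧-≡ s t 𝔸 a ρ))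
  }
ifEqual s t (∀-step p) (∀-step q) with ifEqual (weaken s) (weaken t) p q
... | χ , prenex , spec = (∀′ χ) , ∀-step prenex , record
  { if-≡ = λ 𝔸 ρ eq → Π-cong-⇔ λ a → if-≡ spec 𝔸 (a ∷ ρ) (subst id (sym (⟦weaken⟧-≡ s t 𝔸 a ρ)) eq)
  ; if-≢ = λ 𝔸 ρ neq → Π-cong-⇔ λ a → if-≢ spec 𝔸 (a ∷ ρ) (neq ∘ subst id (⟦weaken⟧-≡ s t 𝔸 a ρ))
  }

-- Letters and copies of segments.

letter : ∀ {k} → Bool → Term k → Formula k
letter true  t = S t
letter false t = ¬′ S t

#quantifiers-letter : ∀ {k} c (t : Term k) → #quantifiers (letter c t) ≡ 0
#quantifiers-letter true  t = refl
#quantifiers-letter false t = refl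

Sat-letter : ∀ {n k} .{{_ : NonZero n}} (w : Vec Bool n) (ρ : Vec (Fin n) k) c t →
             Sat (𝐁 w) ρ (letter c t) ⇔ lookup w (⟦_⟧ (𝐁 w) t ρ) ≡ c
Sat-letter w ρ true  t = mk⇔ (λ eq → eq) (λ eq → eq)
Sat-letter w ρ false t = mk⇔ ¬-not (λ eq eq′ → contradiction (trans (sym eq) eq′) λ ())

-- Additive form of q - p ≤ b - a and i - p = j - a over the integers, which avoids truncated
-- subtraction for guessed endpoints in the wrong order.
record Matches {n} (w : Vec Bool n) (p q : Fin n) (w′ : Vec Bool n) (a b : Fin n) : Set where
  constructor matches
  field
    long-enough : toℕ q + toℕ a ≤ toℕ b + toℕ p
    same-letter : toℕ q + toℕ a ≡ toℕ b + toℕ p →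
      ∀ i j → p ≤ᶠ i → i ≤ᶠ q → toℕ i + toℕ a ≡ toℕ j + toℕ p → lookup w i ≡ lookup w′ j

-- A sum of two inequalities that is tight is tight in each summand; here the
-- summands are r - p ≤ c - a and q - r ≤ b - c, freed of subtraction.
module _ (a b c p q r : ℕ) (l : r + a ≤ c + p) (m : q + c ≤ b + r) where

  private
    rearrangeˡ : (q + a) + (r + c) ≡ (r + a) + (q + c)
    rearrangeˡ = solve 4 (λ q a r c → (q :+ a) :+ (r :+ c) := (r :+ a) :+ (q :+ c)) refl q a r c

    rearrangeʳ : (c + p) + (b + r) ≡ (b + p) + (r + c)
    rearrangeʳ = solve 4 (λ c p b r → (c :+ p) :+ (b :+ r) := (b :+ p) :+ (r :+ c)) refl c p b r

  sum-≤ : q + a ≤ b + p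
  sum-≤ = +-cancelʳ-≤ (r + c) _ _
    (≤-trans (≤-reflexive rearrangeˡ) (≤-trans (+-mono-≤ l m) (≤-reflexive rearrangeʳ)))

  sum-tight : q + a ≡ b + p → r + a ≡ c + p × q + c ≡ b + r
  sum-tight eq = tightˡ , +-cancelˡ-≡ (r + a) _ _ (trans total (cong (_+ (b + r)) (sym tightˡ)))
    where
    total : (r + a) + (q + c) ≡ (c + p) + (b + r)
    total = trans (sym rearrangeˡ) (trans (cong (_+ (r + c)) eq) (sym rearrangeʳ))
    tightˡ : r + a ≡ c + p
    tightˡ = ≤-antisym l (+-cancelʳ-≤ (q + c) _ _
      (≤-trans (+-monoʳ-≤ (c + p) m) (≤-reflexive (sym total))))

Matches-trans : ∀ {n} {w w′ : Vec Bool n} {p r q a c b} →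
                Matches w p r w′ a c → Matches w r q w′ c b → Matches w p q w′ a b
Matches-trans {w = w} {w′} {p} {r} {q} {a} {c} {b} (matches l f) (matches m g) =
  matches (sum-≤ (toℕ a) (toℕ b) (toℕ c) (toℕ p) (toℕ q) (toℕ r) l m) letters
  where
  -- Change of base point: r - p = c - a and i - p = j - a give i - r = j - c, up to the common
  -- summand `a + p`.
  shift : ∀ i j a c p r → r + a ≡ c + p → i + a ≡ j + p → (i + c) + (a + p) ≡ (j + r) + (a + p)
  shift i j a c p r x y = trans
    (solve 4 (λ i c a p → (i :+ c) :+ (a :+ p) := (i :+ a) :+ (c :+ p)) refl i c a p)
    (trans (cong₂ _+_ y (sym x))
      (solve 4 (λ j p r a → (j :+ p) :+ (r :+ a) := (j :+ r) :+ (a :+ p)) refl j p r a))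

  letters : toℕ q + toℕ a ≡ toℕ b + toℕ p →
    ∀ i j → p ≤ᶠ i → i ≤ᶠ q → toℕ i + toℕ a ≡ toℕ j + toℕ p → lookup w i ≡ lookup w′ j
  letters eq i j p≤i i≤q ij
    with sum-tight (toℕ a) (toℕ b) (toℕ c) (toℕ p) (toℕ q) (toℕ r) l m eq | toℕ i ≤? toℕ r
  ... | eqˡ , _   | yes i≤r = f eqˡ i j p≤i i≤r ij
  ... | eqˡ , eqʳ | no  i≰r = g eqʳ i j (<⇒≤ (≰⇒> i≰r)) i≤q
    (+-cancelʳ-≡ (toℕ a + toℕ p) _ _ (shift (toℕ i) (toℕ j) (toℕ a) (toℕ c) (toℕ p) (toℕ r) eqˡ ij))

-- Both segments are whole strings, so the copy is exact, and equal offsets from 0 are equal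
-- positions.
Matches-full : ∀ {n} {w w′ : Vec Bool (suc n)} →
               Matches w zero (fromℕ n) w′ zero (fromℕ n) → w′ ≡ w
Matches-full {n} {w} {w′} (matches _ f) = trans (sym (tabulate∘lookup w′))
  (trans (tabulate-cong λ i → sym (f refl i i z≤n (≤fromℕ i) refl)) (tabulate∘lookup w))

-- The cut point is the smaller of q and p + l; a short segment leaves the degenerate right piece
-- [q, q].
cut : ∀ {n} {p q : Fin n} l m → p ≤ᶠ q → toℕ q ≤ (l + m) + toℕ p →
      ∃[ r ] p ≤ᶠ r × toℕ r ≤ l + toℕ p × r ≤ᶠ q × toℕ q ≤ m + toℕ r
cut {p = p} {q} l m p≤q q≤ with toℕ q ≤? l + toℕ p
... | yes short = q , p≤q , short , ≤-refl , m≤n+m (toℕ q) m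
... | no  long  = r , subst (toℕ p ≤_) (sym r≡) (m≤n+m (toℕ p) l) , ≤-reflexive r≡ ,
                  subst (_≤ toℕ q) (sym r≡) (<⇒≤ (≰⇒> long)) ,
                  ≤-trans q≤ (≤-reflexive (trans rearrange (cong (m +_) (sym r≡))))
  where
  bound = ≤-trans (≰⇒> long) (<⇒≤ (toℕ<n q))
  r = fromℕ< bound
  r≡ : toℕ r ≡ l + toℕ p
  r≡ = toℕ-fromℕ< bound
  rearrange : (l + m) + toℕ p ≡ m + (l + toℕ p)
  rearrange = trans (cong (_+ toℕ p) (+-comm l m)) (+-assoc m l (toℕ p))

-- Formulas describing segments.

module _ {m : ℕ} (w : Vec Bool (3 + m)) where

  private
    n : ℕ
    n = 3 + m

  -- Completeness concerns only `w` at the true endpoints; soundness must cope with every `w′` and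
  -- all values of `a` and `b`, as cut points in `w′` are guessed freely.
  record Describes {k} (p q : Fin n) (a b : Term k) (φ : Formula k) : Set where
    constructor describes
    field
      complete : ∀ ρ → ⟦_⟧ (𝐁 w) a ρ ≡ p → ⟦_⟧ (𝐁 w) b ρ ≡ q → Sat (𝐁 w) ρ φ
      sound    : ∀ w′ ρ → Sat (𝐁 w′) ρ φ → Matches w p q w′ (⟦_⟧ (𝐁 w′) a ρ) (⟦_⟧ (𝐁 w′) b ρ)

  letter-sound : ∀ {k} p (t : Term k) (w′ : Vec Bool n) ρ → Sat (𝐁 w′) ρ (letter (lookup w p) t) →
    ∀ j c → toℕ j + c ≡ toℕ (⟦_⟧ (𝐁 w′) t ρ) + c → lookup w p ≡ lookup w′ j
  letter-sound p t w′ ρ s j c eq = sym (trans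
    (cong (lookup w′) (toℕ-injective (+-cancelʳ-≡ c _ _ eq)))
    (to (Sat-letter w′ ρ (lookup w p) t) s))

  -- Base case for the degenerate pieces left by `cut`.
  describePoint : ∀ {k} p (a b : Term k) → Describes p p a b (a ≐ b ∧′ letter (lookup w p) a)
  describePoint p a b = describes
    (λ { ρ refl eq → sym eq , from (Sat-letter w ρ (lookup w p) a) refl })
    (λ w′ ρ (eq , s) → matches
      (≤-reflexive (trans (+-comm (toℕ p) _) (cong (λ x → toℕ x + toℕ p) eq)))
      (λ _ → letters w′ ρ s))
    where
    letters : ∀ (w′ : Vec Bool n) ρ → Sat (𝐁 w′) ρ (letter (lookup w p) a) →
      ∀ i j → p ≤ᶠ i → i ≤ᶠ p → toℕ i + toℕ (⟦_⟧ (𝐁 w′) a ρ) ≡ toℕ j + toℕ p → lookup w i ≡ lookup w′ j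
    letters w′ ρ s i j p≤i i≤p ij with toℕ-injective {i = i} {p} (≤-antisym i≤p p≤i)
    ... | refl = letter-sound p a w′ ρ s j (toℕ p) (trans (sym ij) (+-comm (toℕ p) _))

  -- Strictness alone gives b - a ≥ 1. Defining the successor would cost a further quantifier;
  -- overlong copies are excluded at the end by the total length.
  describeStep : ∀ {k} {p q} (a b : Term k) → toℕ q ≡ suc (toℕ p) →
    Describes p q a b (a ≺ b ∧′ letter (lookup w p) a ∧′ letter (lookup w q) b)
  describeStep {p = p} {q} a b q≡ = describes
    (λ { ρ refl refl → ≤-reflexive (sym q≡) ,
                       from (Sat-letter w ρ (lookup w p) a) refl ,
                       from (Sat-letter w ρ (lookup w q) b) refl })
    (λ w′ ρ (a<b , s , t) → matches
      (≤-trans (≤-reflexive (trans (cong (_+ toℕ (⟦_⟧ (𝐁 w′) a ρ)) q≡) (cong suc (+-comm (toℕ p) _))))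
        (+-monoˡ-≤ (toℕ p) a<b))
      (letters w′ ρ s t))
    where
    letters : ∀ (w′ : Vec Bool n) ρ → Sat (𝐁 w′) ρ (letter (lookup w p) a) → Sat (𝐁 w′) ρ (letter (lookup w q) b) →
      toℕ q + toℕ (⟦_⟧ (𝐁 w′) a ρ) ≡ toℕ (⟦_⟧ (𝐁 w′) b ρ) + toℕ p →
      ∀ i j → p ≤ᶠ i → i ≤ᶠ q → toℕ i + toℕ (⟦_⟧ (𝐁 w′) a ρ) ≡ toℕ j + toℕ p → lookup w i ≡ lookup w′ j
    letters w′ ρ s t eq i j p≤i i≤q ij with m≤n⇒m<n∨m≡n i≤q
    ... | inj₁ i<q with toℕ-injective {i = i} {p} (≤-antisym (s≤s⁻¹ (≤-trans i<q (≤-reflexive q≡))) p≤i)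
    ...   | refl = letter-sound p a w′ ρ s j (toℕ p) (trans (sym ij) (+-comm (toℕ p) _))
    letters w′ ρ s t eq i j p≤i i≤q ij | inj₂ i≡q with toℕ-injective {i = i} {q} i≡q
    ...   | refl = letter-sound q b w′ ρ t j (toℕ p) (trans (sym ij) eq)

  describe : ∀ {k} d {p q} → p ≤ᶠ q → toℕ q ≤ 3 ^ d + toℕ p → (a b : Term k) →
             ∃[ φ ] PrenexWithPrefix (∃∃∀-blocks d) φ × Describes p q a b φ
  describe zero {p} {q} p≤q q≤ a b with m≤n⇒m<n∨m≡n p≤q
  ... | inj₁ p<q = _ , matrix (cong₂ _+_ (#quantifiers-letter (lookup w p) a) (#quantifiers-letter (lookup w q) b)) ,
                   describeStep a b (≤-antisym q≤ p<q)
  ... | inj₂ p≡q with toℕ-injective {i = p} {q} p≡q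
  ...   | refl = _ , matrix (#quantifiers-letter (lookup w p) a) , describePoint p a b
  describe (suc d) {p} {q} p≤q q≤ a b
    -- `3 ^ suc d` unfolds to `3 ^ d + (3 ^ d + (3 ^ d + 0))`, which dictates the bounds of the two
    -- cuts.
    with r , p≤r , r≤ , r≤q , q≤′ ← cut (3 ^ d) (3 ^ d + (3 ^ d + 0)) p≤q q≤
    with s , r≤s , s≤ , s≤q , q≤″ ← cut (3 ^ d) (3 ^ d + 0) r≤q q≤′
    -- Under the new block, variables 2 and 1 are the cut points and variable 0 is the pick z.
    with φ₁ , prenex₁ , describes complete₁ sound₁ ← describe d p≤r r≤ (weaken (weaken (weaken a))) (var (suc (suc zero)))
       | φ₂ , prenex₂ , describes complete₂ sound₂ ← describe d r≤s s≤ (var (suc (suc zero))) (var (suc zero))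
       | φ₃ , prenex₃ , describes complete₃ sound₃ ← describe d s≤q (subst (λ e → toℕ q ≤ e + toℕ s) (+-identityʳ (3 ^ d)) q≤″)
                                                     (var (suc zero)) (weaken (weaken (weaken b)))
    -- `min` picks the left piece, `max` the middle one, any other z the right one.
    with χ , prenex-χ , spec-χ ← ifEqual (var zero) max prenex₂ prenex₃
    with φ , prenex , spec ← ifEqual (var zero) min prenex₁ prenex-χ
    = (∃′ ∃′ ∀′ φ) , ∃-step (∃-step (∀-step prenex)) , describes complete sound
    where
    ⟦weaken³⟧ : ∀ w′ {k} x y z (ρ : Vec (Fin n) k) t →
      ⟦_⟧ (𝐁 w′) (weaken (weaken (weaken t))) (z ∷ y ∷ x ∷ ρ) ≡ ⟦_⟧ (𝐁 w′) t ρ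
    ⟦weaken³⟧ w′ x y z ρ (var i) = refl
    ⟦weaken³⟧ w′ x y z ρ min     = refl
    ⟦weaken³⟧ w′ x y z ρ max     = refl

    complete : ∀ ρ → ⟦_⟧ (𝐁 w) a ρ ≡ p → ⟦_⟧ (𝐁 w) b ρ ≡ q → Sat (𝐁 w) ρ (∃′ ∃′ ∀′ φ)
    complete ρ a≡p b≡q = r , s , play
      where
      play : ∀ z → Sat (𝐁 w) (z ∷ s ∷ r ∷ ρ) φ
      play z with z ≟ zero | z ≟ fromℕ (2 + m)
      ... | yes z≡min | _         = to (if-≡ spec _ _ z≡min)
        (complete₁ _ (trans (⟦weaken³⟧ w r s z ρ a) a≡p) refl)
      ... | no  z≢min | yes z≡max = to (if-≢ spec _ _ z≢min) (to (if-≡ spec-χ _ _ z≡max)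
        (complete₂ _ refl refl))
      ... | no  z≢min | no  z≢max = to (if-≢ spec _ _ z≢min) (to (if-≢ spec-χ _ _ z≢max)
        (complete₃ _ refl (trans (⟦weaken³⟧ w r s z ρ b) b≡q)))

    sound : ∀ w′ ρ → Sat (𝐁 w′) ρ (∃′ ∃′ ∀′ φ) → Matches w p q w′ (⟦_⟧ (𝐁 w′) a ρ) (⟦_⟧ (𝐁 w′) b ρ)
    sound w′ ρ (x , y , win) = Matches-trans {c = x} piece₁ (Matches-trans {c = y} piece₂ piece₃)
      where
      piece₁ : Matches w p r w′ (⟦_⟧ (𝐁 w′) a ρ) x
      piece₁ = subst (λ c → Matches w p r w′ c x) (⟦weaken³⟧ w′ x y zero ρ a)
        (sound₁ w′ _ (from (if-≡ spec _ _ refl) (win zero)))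
      piece₂ : Matches w r s w′ x y
      piece₂ = sound₂ w′ _
        (from (if-≡ spec-χ _ _ refl) (from (if-≢ spec _ _ λ ()) (win (fromℕ (2 + m)))))
      -- With at least three positions, `suc zero` differs from both `min` and `max`.
      piece₃ : Matches w s q w′ y (⟦_⟧ (𝐁 w′) b ρ)
      piece₃ = subst (Matches w s q w′ y) (⟦weaken³⟧ w′ x y (suc zero) ρ b)
        (sound₃ w′ _ (from (if-≢ spec-χ _ _ λ ()) (from (if-≢ spec _ _ λ ()) (win (suc zero)))))

-- Assembling the separating sentence.

last≤ : ∀ m → toℕ (fromℕ m) ≤ 3 ^ ⌈log₃ suc m ⌉ + 0
-- The last position is n - 1, below the bound n; the summand 0 is the position of `min`.
last≤ m = ≤-trans (<⇒≤ (toℕ<n (fromℕ m)))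
  (≤-trans (≤3^⌈log₃⌉ (suc m)) (≤-reflexive (sym (+-identityʳ _))))

-- The three choices of z need three positions, hence the separate cases n ≤ 2.
separate : ∀ (n : ℕ) .{{_ : NonZero n}} (w : Vec Bool n) →
  ∃[ φ ] PrenexWithPrefix (∃∃∀-blocks ⌈log₃ n ⌉) φ × (𝐁 w ⊨ φ) × (∀ w′ → 𝐁 w′ ⊨ φ → w′ ≡ w)
separate 1 w@(c ∷ []) = letter c min , matrix (#quantifiers-letter c min) , from (Sat-letter w [] c min) refl ,
  λ { w′@(_ ∷ []) s → cong (_∷ []) (to (Sat-letter w′ [] c min) s) }
-- Since ⌈log₃ 2⌉ = 1, one block is prescribed; `min` and `max` already name both positions, so its
-- variables are dummies with arbitrary witnesses.
separate 2 w@(c ∷ d ∷ []) = (∃′ ∃′ ∀′ (letter c min ∧′ letter d max)) ,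
  ∃-step (∃-step (∀-step (matrix (cong₂ _+_ (#quantifiers-letter c min) (#quantifiers-letter d max))))) ,
  (zero , zero , λ z → from (Sat-letter w (z ∷ _) c min) refl , from (Sat-letter w (z ∷ _) d max) refl) ,
  λ { w′@(_ ∷ _ ∷ []) (_ , _ , f) → let s , t = f zero in
      cong₂ (λ x y → x ∷ y ∷ []) (to (Sat-letter w′ (zero ∷ _) c min) s) (to (Sat-letter w′ (zero ∷ _) d max) t) }
separate n@(suc (suc (suc m))) w
  with φ , prenex , describes complete sound ← describe w ⌈log₃ n ⌉ {zero} {fromℕ (2 + m)} z≤n (last≤ (2 + m)) min max
  = φ , prenex , complete [] refl refl , λ w′ s → Matches-full (sound w′ [] s)

mainTheorem9 : ∀ (n : ℕ) .{{_ : NonZero n}} (w : Vec Bool n) →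
    Σ Sentence λ φ →
    PrenexWithPrefix (∃∃∀-blocks ⌈log₃ n ⌉) φ
    × #quantifiers φ ≡ 3 * ⌈log₃ n ⌉
    × (𝐁 w ⊨ φ)
    × (∀ (w′ : Vec Bool n) → w′ ≢ w → ¬ (𝐁 w′ ⊨ φ))
mainTheorem9 n w with φ , prenex , holds , unique ← separate n w
  = φ , prenex , trans (#quantifiers-prefix prenex) (length-∃∃∀-blocks ⌈log₃ n ⌉) , holds ,
    λ w′ w′≢w s → w′≢w (unique w′ s)
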